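{- There is an algorithm that, given a temporal star $(G_s,L)$ on $n$ vertices in which every edge has at most $3$ labels and all labels are distinct (no integer is a label of two different edges, and the labels of each edge are distinct), decides in $O(n\log n)$ time whether $(G_s,L)$ is explorable (i.e.\ solves \textsc{StarExp(3)} on such instances).
   Context: A temporal graph is a pair $(G,L)$ where $G=(V,E)$ is a graph and $L:E\to 2^{\mathbb{N}}$ assigns to each edge a set of positive integer labels (the discrete times at which the edge is available). A temporal star is a temporal graph whose underlying graph $G_s$ is a star with center $c$ and $n-1$ leaves. A time edge is a triple $(u,v,l)$ with $\{u,v\}\in E$ and $l\in L(\{u,v\})$. A journey from $u$ to $v$ is a sequence of time edges $(u,u_1,l_1),(u_1,u_2,l_2),\dots,(u_{r-1},v,l_r)$ with $l_1<l_2<\dots<l_r$. The temporal star $(G_s,L)$ is explorable if there is a journey starting and ending at the center $c$ that visits every vertex of $G_s$. The decision problem \textsc{StarExp($k$)} takes as input a temporal star in which every edge has at most $k$ labels and asks whether it is explorable. -}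

module Defs where

open import Data.Bool using (if_then_else_)
open import Data.Fin using (Fin; zero; suc)
open import Data.List using (List; []; _∷_; length; concat; tabulate)
open import Data.List.Membership.Propositional using (_∈_; _∉_)
open import Data.List.Relation.Unary.All as All using (All)
open import Data.List.Relation.Unary.Unique.Propositional using (Unique)
open import Data.Nat using (ℕ; zero; suc; _+_; _*_; _∸_; _≤_; _<_; _≡ᵇ_)
open import Data.Product using (Σ; ∃-syntax; _×_; _,_)
open import Data.Sum using (_⊎_)
open import Relation.Binary.PropositionalEquality using (_≡_; _≢_; refl)
open import Relation.Nullary using (¬_; contradiction)
open import Relation.Unary using (Pred; _⊆_)
open import Level using (0ℓ)

------------------------------------------------------------------------
-- Temporal graphs

record Graph (V : Set) : Set₁ where
  field
    Adj    : V → V → Set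
    sym    : ∀ {u v} → Adj u v → Adj v u
    irrefl : ∀ {v} → ¬ Adj v v

record TemporalGraph (V : Set) : Set₁ where
  field
    graph : Graph V
  open Graph graph public
  field
    L        : ∀ {u v} → Adj u v → Pred ℕ 0ℓ
    L-sym    : ∀ {u v} (e : Adj u v) → L (sym e) ⊆ L e
    positive : ∀ {u v} (e : Adj u v) {l} → L e l → 0 < l

module _ {V : Set} (𝒢 : TemporalGraph V) where
  open TemporalGraph 𝒢

  TimeEdge : V → V → ℕ → Set
  TimeEdge u v l = Σ (Adj u v) λ e → L e l

  -- JourneyAfter t u v: sequences of time edges leading from u to v whose
  -- labels are strictly increasing and all greater than t.
  data JourneyAfter (t : ℕ) : V → V → Set where
    []  : ∀ {v} → JourneyAfter t v v
    _∷_ : ∀ {u w v l} → TimeEdge u w l × t < l → JourneyAfter l w v →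
          JourneyAfter t u v

  -- The bound 0 is no restriction, as labels are positive.
  Journey : V → V → Set
  Journey = JourneyAfter 0

  visited : ∀ {t u v} → JourneyAfter t u v → List V
  visited {v = v} []      = v ∷ []
  visited {u = u} (_ ∷ J) = u ∷ visited J

  ExplorableFrom : V → Set
  ExplorableFrom c = Σ (Journey c c) λ J → ∀ v → v ∈ visited J

------------------------------------------------------------------------
-- Temporal stars

-- A star with m leaves, i.e. on n = suc m vertices: the centre is zero and
-- the leaves are suc i for i : Fin m.
data StarAdj {m : ℕ} : Fin (suc m) → Fin (suc m) → Set where
  outward : ∀ i → StarAdj zero (suc i)
  inward  : ∀ i → StarAdj (suc i) zero

starGraph : ∀ m → Graph (Fin (suc m))
starGraph m = record
  { Adj    = StarAdj
  ; sym    = λ { (outward i) → inward i ; (inward i) → outward i }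
  ; irrefl = λ ()
  }

-- The label set of each edge is finite and is given by a repetition-free list,
-- in no particular order.
record TemporalStar (m : ℕ) : Set where
  field
    labels   : Fin m → List ℕ
    unique   : ∀ i → Unique (labels i)
    positive : ∀ i → All (0 <_) (labels i)

module _ {m : ℕ} (S : TemporalStar m) where
  open TemporalStar S

  private
    starL : ∀ {u v : Fin (suc m)} → StarAdj u v → Pred ℕ 0ℓ
    starL (outward i) l = l ∈ labels i
    starL (inward i)  l = l ∈ labels i

  temporalGraph : TemporalGraph (Fin (suc m))
  temporalGraph = record
    { graph    = starGraph m
    ; L        = starL
    ; L-sym    = λ { (outward _) p → p ; (inward _) p → p }
    ; positive = λ { (outward i) → All.lookup (positive i)
                   ; (inward i)  → All.lookup (positive i) }
    }

  Explorable : Set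
  Explorable = ExplorableFrom temporalGraph zero

  LabelsPerEdge≤ : ℕ → Set
  LabelsPerEdge≤ k = ∀ i → length (labels i) ≤ k

  -- Labels of the same edge are distinct by `unique`.
  AllLabelsDistinct : Set
  AllLabelsDistinct = ∀ {i j} → i ≢ j → ∀ {l} → l ∈ labels i → l ∉ labels j

------------------------------------------------------------------------
-- Random access machines
--
-- Structured programs for a unit-cost RAM: registers and memory cells hold
-- natural numbers, the arithmetic operations are addition and truncated
-- subtraction, and memory is addressed indirectly.  Every operation, constant
-- and register access takes one time unit.

Reg : Set
Reg = ℕ

record State : Set where
  constructor ⟨_,_⟩
  field
    reg : Reg → ℕ
    mem : ℕ → ℕ

open State public

_[_↦_] : (ℕ → ℕ) → ℕ → ℕ → (ℕ → ℕ)
(f [ x ↦ v ]) y = if x ≡ᵇ y then v else f y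

infixl 7 _⊕_ _⊖_
infix  5 _≔_ M[_]≔_
infixr 4 _⨾_

data Expr : Set where
  lit     : ℕ → Expr
  var     : Reg → Expr
  _⊕_ _⊖_ : Expr → Expr → Expr
  M[_]    : Expr → Expr

⟦_⟧ : Expr → State → ℕ
⟦ lit n ⟧ σ   = n
⟦ var x ⟧ σ   = reg σ x
⟦ e ⊕ f ⟧ σ   = ⟦ e ⟧ σ + ⟦ f ⟧ σ
⟦ e ⊖ f ⟧ σ   = ⟦ e ⟧ σ ∸ ⟦ f ⟧ σ
⟦ M[ e ] ⟧ σ  = mem σ (⟦ e ⟧ σ)

cost : Expr → ℕ
cost (lit _)  = 1
cost (var _)  = 1
cost (e ⊕ f)  = suc (cost e + cost f)
cost (e ⊖ f)  = suc (cost e + cost f)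
cost M[ e ]   = suc (cost e)

data Program : Set where
  skip              : Program
  _≔_               : Reg → Expr → Program
  M[_]≔_            : Expr → Expr → Program
  _⨾_               : Program → Program → Program
  if≢0_then_else_   : Expr → Program → Program → Program
  while≢0_loop_       : Expr → Program → Program

-- p , σ ⇓[ t ] τ: program p started in state σ halts in state τ after
-- exactly t time units.
infix 3 _,_⇓[_]_

data _,_⇓[_]_ : Program → State → ℕ → State → Set where
  skip : ∀ {σ} → skip , σ ⇓[ 1 ] σ

  assign : ∀ {σ x e} →
    x ≔ e , σ ⇓[ suc (cost e) ] ⟨ reg σ [ x ↦ ⟦ e ⟧ σ ] , mem σ ⟩

  store : ∀ {σ e f} →
    M[ e ]≔ f , σ ⇓[ suc (cost e + cost f) ]
      ⟨ reg σ , mem σ [ ⟦ e ⟧ σ ↦ ⟦ f ⟧ σ ] ⟩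

  seq : ∀ {p q σ τ υ s t} →
    p , σ ⇓[ s ] τ → q , τ ⇓[ t ] υ → p ⨾ q , σ ⇓[ s + t ] υ

  if-true : ∀ {e p q σ τ t} → ⟦ e ⟧ σ ≢ 0 →
    p , σ ⇓[ t ] τ → if≢0 e then p else q , σ ⇓[ suc (cost e) + t ] τ

  if-false : ∀ {e p q σ τ t} → ⟦ e ⟧ σ ≡ 0 →
    q , σ ⇓[ t ] τ → if≢0 e then p else q , σ ⇓[ suc (cost e) + t ] τ

  while-stop : ∀ {e p σ} → ⟦ e ⟧ σ ≡ 0 →
    while≢0 e loop p , σ ⇓[ suc (cost e) ] σ

  while-loop : ∀ {e p σ τ υ s t} → ⟦ e ⟧ σ ≢ 0 →
    p , σ ⇓[ s ] τ → while≢0 e loop p , τ ⇓[ t ] υ →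
    while≢0 e loop p , σ ⇓[ suc (cost e) + (s + t) ] υ

⇓-deterministic : ∀ {p σ s t τ υ} →
  p , σ ⇓[ s ] τ → p , σ ⇓[ t ] υ → s ≡ t × τ ≡ υ
⇓-deterministic skip skip = refl , refl
⇓-deterministic assign assign = refl , refl
⇓-deterministic store store = refl , refl
⇓-deterministic (seq a b) (seq a′ b′)
  with refl , refl ← ⇓-deterministic a a′
  with refl , refl ← ⇓-deterministic b b′ = refl , refl
⇓-deterministic (if-true _ a) (if-true _ a′)
  with refl , refl ← ⇓-deterministic a a′ = refl , refl
⇓-deterministic (if-true ≢0 _) (if-false ≡0 _) = contradiction ≡0 ≢0
⇓-deterministic (if-false ≡0 _) (if-true ≢0 _) = contradiction ≡0 ≢0
⇓-deterministic (if-false _ a) (if-false _ a′)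
  with refl , refl ← ⇓-deterministic a a′ = refl , refl
⇓-deterministic (while-stop _) (while-stop _) = refl , refl
⇓-deterministic (while-stop ≡0) (while-loop ≢0 _ _) = contradiction ≡0 ≢0
⇓-deterministic (while-loop ≢0 _ _) (while-stop ≡0) = contradiction ≡0 ≢0
⇓-deterministic (while-loop _ a b) (while-loop _ a′ b′)
  with refl , refl ← ⇓-deterministic a a′
  with refl , refl ← ⇓-deterministic b b′ = refl , refl

------------------------------------------------------------------------
-- Deciding explorability

-- The input is the number of vertices followed, for every leaf, by the number
-- of labels of its edge and these labels.
encode : ∀ {m} → TemporalStar m → List ℕ
encode {m} S = suc m ∷ concat (tabulate λ i → length (labels i) ∷ labels i)
  where open TemporalStar S

-- The input occupies the memory from address 0 on; everything else is 0.
cells : List ℕ → ℕ → ℕ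
cells []       _       = 0
cells (x ∷ _)  zero    = x
cells (_ ∷ xs) (suc a) = cells xs a

initial : List ℕ → State
initial input = ⟨ (λ _ → 0) , cells input ⟩

-- p halts on the given input within the given time; it answers 1 in register 0
-- if A holds, and 0 if it does not.
Decides : Program → Set → List ℕ → ℕ → Set
Decides p A input time =
  ∃[ t ] ∃[ τ ] (p , initial input ⇓[ t ] τ) × t ≤ time ×
    ((reg τ 0 ≡ 1 × A) ⊎ (reg τ 0 ≡ 0 × ¬ A))

_∈O_ : (ℕ → ℕ) → (ℕ → ℕ) → Set
f ∈O g = ∃[ c ] ∃[ n₀ ] ∀ n → n₀ ≤ n → f n ≤ c * g n

{-# OPTIONS --safe #-}
module Submission where

-- A leaf with sorted labels a < b < c is visited during [a, b] or [b, c] (or [a, c],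
-- which is never better), and every choice contains the middle label b.  Hence the
-- visits of an exploration occur in the order of the middle labels, and it is optimal
-- to scan the leaves in this order, always preferring [a, b], which ends earlier.  A
-- leaf with two labels is treated as a = 0, which excludes [a, b].  The time is
-- dominated by sorting: merge sort repeatedly merges the first two runs of a queue and
-- appends the result, and ⌈log₂ n⌉ rounds of linear total cost leave a single run.

open import Data.Bool using (true; false; if_then_else_; T)
open import Data.Fin as Fin using (Fin)
open import Data.List
  using (List; []; _∷_; [_]; _++_; map; length; foldl; replicate; concat; concatMap; merge;
         tabulate; allFin)
open import Data.List.Membership.Propositional using (_∈_)
open import Data.List.Membership.Propositional.Properties using (∈-allFin; ∈-++⁺ʳ)
open import Data.List.Properties
  using (length-++; length-map; length-tabulate; map-++; map-tabulate; ++-assoc; ++-identityʳ;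
         concatMap-++; concat-++)
open import Data.List.Relation.Binary.Permutation.Propositional as ↭
  using (_↭_; ↭-refl; ↭-sym; ↭-trans; ↭-reflexive; ↭⇒↭ₛ; prep; module PermutationReasoning)
open import Data.List.Relation.Binary.Permutation.Propositional.Properties
  using (∈-resp-↭; ↭-map-inv; ↭-length; drop-∷; shift; ++⁺ˡ; ++⁺ʳ; ++-comm; merge-↭)
import Data.List.Relation.Binary.Permutation.Setoid.Properties as ↭ₛ
open import Data.List.Relation.Unary.All as All using (All; []; _∷_)
import Data.List.Relation.Unary.All.Properties as All
open import Data.List.Relation.Unary.AllPairs as AllPairs using (AllPairs; []; _∷_)
open import Data.List.Relation.Unary.AllPairs.Properties using (map⁻)
open import Data.List.Relation.Unary.Any using (here; there)
open import Data.List.Relation.Unary.Linked using ([]; [-])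
open import Data.List.Relation.Unary.Sorted.TotalOrder using (Sorted)
open import Data.List.Relation.Unary.Sorted.TotalOrder.Properties using (merge⁺; Sorted⇒AllPairs)
open import Data.List.Relation.Unary.Unique.Propositional using (Unique)
open import Data.List.Relation.Unary.Unique.Propositional.Properties using (allFin⁺)
open import Data.Nat
  using (ℕ; zero; suc; _+_; _*_; _∸_; _^_; _≤_; _<_; z≤n; s≤s; _≡ᵇ_; _≤?_; ⌊_/2⌋; ⌈_/2⌉)
open import Data.Nat.ListAction using (sum)
open import Data.Nat.ListAction.Properties using (sum-++)
open import Data.Nat.Logarithm using (⌈log₂_⌉; ⌈log₂⌉-mono-≤; ⌈log₂⌈n/2⌉⌉≡⌈log₂n⌉∸1)
open import Data.Nat.Properties
open import Data.Nat.Solver using (module +-*-Solver)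
open import Algebra.Properties.CommutativeSemigroup +-commutativeSemigroup using (x∙yz≈y∙xz)
open import Data.Product using (Σ; ∃-syntax; _×_; _,_; proj₁; proj₂)
open import Data.Sum using (_⊎_; inj₁; inj₂)
open import Data.Unit using (tt)
open import Function using (_∘_; id)
open import Relation.Binary.Bundles using (DecTotalOrder)
import Relation.Binary.Construct.On as On
open import Relation.Binary.PropositionalEquality
  using (_≡_; _≢_; refl; sym; trans; cong; cong₂; subst; subst₂; setoid; resp₂)
open import Relation.Nullary using (¬_; yes; no; contradiction)
open import Relation.Nullary.Decidable using (dec-true; dec-false)
open import Defs
open +-*-Solver using (solve; con; _:+_; _:*_; _:=_)

-- Correctness splits at `Greedy`, a predicate on lists of triples that knows nothing of journeys or
-- machines: the first half relates it to explorability, the second half computes it. Zero padding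
-- lets one predicate cover all leaves: a leaf with fewer than two labels gets middle label 0, fails
-- both tests of the scan, and indeed cannot be entered and left at increasing times. The machine
-- has loops but no recursion, which is why the sort is driven by a queue and not by a call tree.
-- Merged runs always go to fresh cells at the end of the queue, so reasoning about untouched memory
-- reduces to agreement below one address.

-- Intervals and the greedy scan

-- The labels of a leaf in increasing order, padded with zeros at the front.  The
-- padding is never an admissible start, as the greedy scan starts after time 0.
record Triple : Set where
  constructor ⟪_,_,_⟫
  field
    lo mid hi : ℕ
open Triple

-- The guard `¬ e < lo t` in `right` makes the choice deterministic. A failed run of the scan
-- therefore refutes `Greedy` outright, without considering alternative choices.
data Greedy (e : ℕ) : List Triple → Set where
  []    : Greedy e []
  left  : ∀ {t ts} → e < lo t → Greedy (mid t) ts → Greedy e (t ∷ ts)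
  right : ∀ {t ts} → ¬ e < lo t → e < mid t → Greedy (hi t) ts → Greedy e (t ∷ ts)

-- Every way of visiting the leaf is dominated by [lo, mid] or by [mid, hi].
record Represents (ls : List ℕ) (t : Triple) : Set where
  field
    mid≤hi    : mid t ≤ hi t
    earlier   : 0 < lo t → lo t ∈ ls × mid t ∈ ls × lo t < mid t
    later     : 0 < mid t → mid t ∈ ls × hi t ∈ ls × mid t < hi t
    dominated : ∀ {s f} → s ∈ ls → f ∈ ls → s < f →
      (s ≤ lo t × mid t ≤ f) ⊎ (s ≤ mid t × hi t ≤ f)

module _ {m : ℕ} (S : TemporalStar m) (triple : Fin m → Triple)
         (represents : ∀ i → Represents (TemporalStar.labels S i) (triple i)) where
  open TemporalStar S using (labels)
  private
    module R i = Represents (represents i)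
    𝒢 = temporalGraph S

    Tour : ℕ → Set
    Tour e = JourneyAfter 𝒢 e Fin.zero Fin.zero

  visit : ∀ {e} i {s f} → s ∈ labels i → e < s → f ∈ labels i → s < f →
    Tour f → Tour e
  visit i {s} {f} s∈ e<s f∈ s<f J =
    _∷_ {l = s} ((outward i , s∈) , e<s) (_∷_ {l = f} ((inward i , f∈) , s<f) J)

  greedy-journey : ∀ {e} is → Greedy e (map triple is) →
    Σ (Tour e) λ J → ∀ {i} → i ∈ is → Fin.suc i ∈ visited 𝒢 J
  greedy-journey []       []           = [] , λ ()
  greedy-journey (i ∷ is) (left e<a g)
    with a∈ , b∈ , a<b ← R.earlier i (≤-<-trans z≤n e<a)
    with J , J-visits ← greedy-journey is g = visit i a∈ e<a b∈ a<b J ,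
    λ { (here refl) → there (here refl) ; (there j∈) → there (there (J-visits j∈)) }
  greedy-journey (i ∷ is) (right _ e<b g)
    with b∈ , c∈ , b<c ← R.later i (≤-<-trans z≤n e<b)
    with J , J-visits ← greedy-journey is g = visit i b∈ e<b c∈ b<c J ,
    λ { (here refl) → there (here refl) ; (there j∈) → there (there (J-visits j∈)) }

  -- In a star, a walk from the centre to the centre leaves along an edge and must return along the
  -- same one, so every tour is a sequence of visits. Indexing by the tour records the position of a
  -- visit in it, which makes two visits of the same tour comparable.
  data Excursion (i : Fin m) (s f : ℕ) : ∀ {e} → Tour e → Set where
    here  : ∀ {e s∈ f∈ J} {e<s : e < s} {s<f : s < f} → Excursion i s f (visit i s∈ e<s f∈ s<f J)
    there : ∀ {e j x y x∈ y∈ J} {e<x : e < x} {x<y : x < y} → Excursion i s f J →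
      Excursion i s f (visit j x∈ e<x y∈ x<y J)

  excursion : ∀ {e i} (J : Tour e) → Fin.suc i ∈ visited 𝒢 J →
    ∃[ s ] ∃[ f ] Excursion i s f J
  excursion []                                                   (here ())
  excursion []                                                   (there ())
  excursion (((outward _ , _) , _) ∷ (((inward _ , _) , _) ∷ J)) (there (here refl)) =
    _ , _ , here
  excursion (((outward _ , _) , _) ∷ (((inward _ , _) , _) ∷ J)) (there (there i∈))
    with s , f , x ← excursion J i∈ = s , f , there x

  excursion-start : ∀ {e i s f} {J : Tour e} → Excursion i s f J → e < s
  excursion-start (here {e<s = e<s})                = e<s
  excursion-start (there {e<x = e<x} {x<y = x<y} x) =
    <-trans e<x (<-trans x<y (excursion-start x))

  excursion-labels : ∀ {e i s f} {J : Tour e} → Excursion i s f J →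
    s ∈ labels i × f ∈ labels i × s < f
  excursion-labels (here {s∈ = s∈} {f∈ = f∈} {s<f = s<f}) = s∈ , f∈ , s<f
  excursion-labels (there x)                              = excursion-labels x

  excursions-disjoint : ∀ {e i j s f s′ f′} {J : Tour e} →
    i ≢ j → Excursion i s f J → Excursion j s′ f′ J → f < s′ ⊎ f′ < s
  excursions-disjoint i≢j here      here      = contradiction refl i≢j
  excursions-disjoint i≢j here      (there y) = inj₁ (excursion-start y)
  excursions-disjoint i≢j (there x) here      = inj₂ (excursion-start x)
  excursions-disjoint i≢j (there x) (there y) = excursions-disjoint i≢j x y

  module _ (explorable : Explorable S) where
    private
      J = proj₁ explorable
      -- A leaf may be visited several times; the membership proof in `explorable` selects one visit
      -- per leaf.
      start end : Fin m → ℕ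
      start i = proj₁ (excursion J (proj₂ explorable (Fin.suc i)))
      end i   = proj₁ (proj₂ (excursion J (proj₂ explorable (Fin.suc i))))
      exc : ∀ i → Excursion i (start i) (end i) J
      exc i   = proj₂ (proj₂ (excursion J (proj₂ explorable (Fin.suc i))))

      dom : ∀ i → (start i ≤ lo (triple i) × mid (triple i) ≤ end i) ⊎
                  (start i ≤ mid (triple i) × hi (triple i) ≤ end i)
      dom i with s∈ , f∈ , s<f ← excursion-labels (exc i) = R.dominated i s∈ f∈ s<f

      start≤mid : ∀ i → start i ≤ mid (triple i)
      start≤mid i with dom i
      ... | inj₂ (s≤b , _)   = s≤b
      ... | inj₁ (s≤a , b≤f) = s≤mid
        where
        s≤mid : start i ≤ mid (triple i)
        s≤mid with m≤n⇒m<n∨m≡n (z≤n {lo (triple i)})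
        ... | inj₁ 0<a = ≤-trans s≤a (<⇒≤ (proj₂ (proj₂ (R.earlier i 0<a))))
        ... | inj₂ 0≡a = ≤-trans s≤a (≤-trans (≤-reflexive (sym 0≡a)) z≤n)

      mid≤end : ∀ i → mid (triple i) ≤ end i
      mid≤end i with dom i
      ... | inj₁ (_ , b≤f) = b≤f
      ... | inj₂ (_ , c≤f) = ≤-trans (R.mid≤hi i) c≤f

      -- Each excursion contains the middle label, so disjoint excursions are
      -- ordered like their middle labels.
      end<start : ∀ {i j} → mid (triple i) ≤ mid (triple j) × i ≢ j → end i < start j
      end<start {i} {j} (bi≤bj , i≢j) with excursions-disjoint i≢j (exc i) (exc j)
      ... | inj₁ lt = lt
      ... | inj₂ lt = contradiction bi≤bj
        (<⇒≱ (≤-<-trans (mid≤end j) (<-≤-trans lt (start≤mid i))))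

      -- Greedy stays ahead of the tour. After `left` the clock shows `mid`, which is at most the
      -- end of the tour's own visit. Before `right` the clock has reached `lo`, so the tour's visit
      -- starts after `lo`, is dominated by [mid, hi], and ends no earlier than `hi`. Either way the
      -- remaining visits still start after the clock.
      chain-greedy : ∀ {e} is → All (λ i → e < start i) is →
        AllPairs (λ i j → end i < start j) is → Greedy e (map triple is)
      chain-greedy []       []          []               = []
      chain-greedy {e} (i ∷ is) (e<s ∷ _) (f<ss ∷ chain) with e <? lo (triple i)
      ... | yes e<a = left e<a
        (chain-greedy is (All.map (≤-<-trans (mid≤end i)) f<ss) chain)
      ... | no e≮a with dom i
      ...   | inj₁ (s≤a , _)   = contradiction (<-≤-trans e<s s≤a) e≮a
      ...   | inj₂ (s≤b , c≤f) = right e≮a (<-≤-trans e<s s≤b)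
        (chain-greedy is (All.map (≤-<-trans c≤f) f<ss) chain)

    explorable-greedy : ∀ {is} → Unique is →
      AllPairs (λ i j → mid (triple i) ≤ mid (triple j)) is → Greedy 0 (map triple is)
    explorable-greedy {is} unique sorted = chain-greedy is
      (All.universal (excursion-start ∘ exc) is)
      (AllPairs.map end<start (AllPairs.zip (sorted , unique)))

  -- Stated for every sorted permutation of the triples, so that nothing but sortedness and the
  -- permutation property has to be known of the sorting program. The order of the leaves behind
  -- `ts` is recovered by `↭-map-inv`.
  greedy-decides : ∀ {ts} → ts ↭ map triple (allFin m) →
    AllPairs (λ t u → mid t ≤ mid u) ts →
    (Greedy 0 ts → Explorable S) × (¬ Greedy 0 ts → ¬ Explorable S)
  greedy-decides ts↭ sorted with is , refl , is↭ ← ↭-map-inv triple (↭-sym ts↭) =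
    sound , λ ¬g x → ¬g (explorable-greedy x
      (↭ₛ.Unique-resp-↭ (setoid _) (↭⇒↭ₛ is↭) (allFin⁺ m)) (map⁻ sorted))
    where
    sound : Greedy 0 (map triple is) → Explorable S
    sound g with J , J-visits ← greedy-journey is g = J , λ
      { Fin.zero → zero∈ J ; (Fin.suc i) → J-visits (∈-resp-↭ is↭ (∈-allFin i)) }
      where
      zero∈ : ∀ {e} (J : Tour e) → Fin.zero ∈ visited 𝒢 J
      zero∈ []      = here refl
      zero∈ (_ ∷ _) = here refl

-- Sorting the labels of one leaf.

-- x ∸ (x ∸ y) is the minimum and y + (x ∸ y) the maximum of x and y.  The lowest
-- entry of the triple is overwritten: it is still 0 before the third insertion.
insert : Triple → ℕ → Triple
insert ⟪ _ , b , c ⟫ x =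
  ⟪ x ∸ (x ∸ b) , y ∸ (y ∸ c) , c + (y ∸ c) ⟫
  where y = b + (x ∸ b)

triple-of : List ℕ → Triple
triple-of = foldl insert ⟪ 0 , 0 , 0 ⟫

toList : Triple → List ℕ
toList ⟪ a , b , c ⟫ = a ∷ b ∷ c ∷ []

Ordered : Triple → Set
Ordered ⟪ a , b , c ⟫ = a ≤ b × b ≤ c

sort₂-↭ : ∀ x y {xs} → (x ∸ (x ∸ y)) ∷ (y + (x ∸ y)) ∷ xs ↭ x ∷ y ∷ xs
sort₂-↭ x y with ≤-total x y
... | inj₁ x≤y rewrite m≤n⇒m∸n≡0 x≤y | +-identityʳ y = ↭-refl
... | inj₂ y≤x rewrite m∸[m∸n]≡n y≤x | m+[n∸m]≡n y≤x = ↭.swap y x ↭-refl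

sort₂-≤ : ∀ x y → x ∸ (x ∸ y) ≤ y + (x ∸ y)
sort₂-≤ x y with ≤-total x y
... | inj₁ x≤y rewrite m≤n⇒m∸n≡0 x≤y | +-identityʳ y = x≤y
... | inj₂ y≤x rewrite m∸[m∸n]≡n y≤x | m+[n∸m]≡n y≤x = y≤x

min≤ : ∀ x y → x ∸ (x ∸ y) ≤ y
min≤ x y with ≤-total x y
... | inj₁ x≤y = ≤-trans (m∸n≤m x (x ∸ y)) x≤y
... | inj₂ y≤x = ≤-reflexive (m∸[m∸n]≡n y≤x)

insert-↭ : ∀ t x → toList (insert t x) ↭ x ∷ mid t ∷ hi t ∷ []
insert-↭ ⟪ _ , b , c ⟫ x =
  ↭-trans (prep _ (sort₂-↭ (b + (x ∸ b)) c)) (sort₂-↭ x b)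

insert-ordered : ∀ t x → Ordered t → Ordered (insert t x)
insert-ordered ⟪ _ , b , c ⟫ x (_ , b≤c) = lo≤ , sort₂-≤ y c
  where
  y = b + (x ∸ b)
  lo≤ : x ∸ (x ∸ b) ≤ y ∸ (y ∸ c)
  lo≤ with ≤-total y c
  ... | inj₁ y≤c rewrite m≤n⇒m∸n≡0 y≤c = sort₂-≤ x b
  ... | inj₂ c≤y rewrite m∸[m∸n]≡n c≤y = ≤-trans (min≤ x b) b≤c

-- The smallest entry of an ordered triple containing 0 is itself 0, so cancelling that 0 cancels
-- `lo`. This justifies that `insert` overwrites `lo`.
ordered-zero : ∀ t {ls} → Ordered t → toList t ↭ 0 ∷ ls → mid t ∷ hi t ∷ [] ↭ ls
ordered-zero ⟪ a , b , c ⟫ (a≤b , b≤c) t↭ with ∈-resp-↭ (↭-sym t↭) (here refl)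
... | here refl                 = drop-∷ t↭
... | there (here refl)         with refl ← n≤0⇒n≡0 a≤b = drop-∷ t↭
... | there (there (here refl)) with refl ← n≤0⇒n≡0 (≤-trans a≤b b≤c) = drop-∷ t↭

-- Loop invariant: the triple holds the labels `ps` inserted so far and `k` padding zeros, and each
-- insertion spends one zero.
foldl-insert : ∀ k ls {t ps} → length ls ≤ k → Ordered t → toList t ↭ replicate k 0 ++ ps →
  Ordered (foldl insert t ls) ×
  toList (foldl insert t ls) ↭ replicate (k ∸ length ls) 0 ++ (ls ++ ps)
foldl-insert k       []       _          ord t↭ = ord , t↭
foldl-insert (suc k) (x ∷ ls) {t} {ps} (s≤s len≤k) ord t↭
  with ord′ , t′↭ ← foldl-insert k ls {ps = x ∷ ps} len≤k (insert-ordered t x ord)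
    (↭-trans (insert-↭ t x)
      (↭-trans (prep x (ordered-zero t ord t↭)) (↭-sym (shift x (replicate k 0) ps)))) =
  ord′ , ↭-trans t′↭ (++⁺ˡ (replicate (k ∸ length ls) 0) (shift x ls ps))

represents-triple-of : ∀ {ls} → length ls ≤ 3 → Unique ls → Represents ls (triple-of ls)
represents-triple-of {ls} len≤3 unique
  with triple-of ls | foldl-insert 3 ls {⟪ 0 , 0 , 0 ⟫} {[]} len≤3 (z≤n , z≤n) ↭-refl
... | t@(⟪ a , b , c ⟫) | (a≤b , b≤c) , t↭ = record
  { mid≤hi    = b≤c
  ; earlier   = λ 0<a → positive-∈ 0<a (here refl) ,
      positive-∈ (<-≤-trans 0<a a≤b) (there (here refl)) ,
      ≤∧≢⇒< a≤b λ a≡b → <⇒≢ 0<a (sym (a≡b⇒a≡0 a≡b))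
  ; later     = λ 0<b → positive-∈ 0<b (there (here refl)) ,
      positive-∈ (<-≤-trans 0<b b≤c) (there (there (here refl))) ,
      ≤∧≢⇒< b≤c λ b≡c → <⇒≢ 0<b (sym (b≡c⇒b≡0 b≡c))
  ; dominated = λ s∈ f∈ → dominated (∈t s∈) (∈t f∈)
  }
  where
  k = 3 ∸ length ls

  -- Distinctness up to padding: only zeros may repeat. The relation is symmetric, as its transport
  -- along the permutation `t↭′` requires.
  _≈₀_ : ℕ → ℕ → Set
  x ≈₀ y = x ≡ y → x ≡ 0

  t↭′ : toList t ↭ replicate k 0 ++ ls
  t↭′ = ↭-trans t↭ (++⁺ˡ (replicate k 0) (↭-reflexive (++-identityʳ ls)))

  ∈t : ∀ {x} → x ∈ ls → x ∈ toList t
  ∈t x∈ = ∈-resp-↭ (↭-sym t↭′) (∈-++⁺ʳ (replicate k 0) x∈)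

  ∈-zeros : ∀ {x} k → 0 < x → x ∈ replicate k 0 ++ ls → x ∈ ls
  ∈-zeros zero    0<x x∈         = x∈
  ∈-zeros (suc k) ()  (here refl)
  ∈-zeros (suc k) 0<x (there x∈) = ∈-zeros k 0<x x∈

  positive-∈ : ∀ {x} → 0 < x → x ∈ toList t → x ∈ ls
  positive-∈ 0<x x∈ = ∈-zeros k 0<x (∈-resp-↭ t↭′ x∈)

  padded-unique : ∀ k → AllPairs _≈₀_ (replicate k 0 ++ ls)
  padded-unique zero    = AllPairs.map (λ x≢y x≡y → contradiction x≡y x≢y) unique
  padded-unique (suc k) = All.universal (λ _ _ → refl) _ ∷ padded-unique k

  t-unique : AllPairs _≈₀_ (toList t)
  t-unique = ↭ₛ.AllPairs-resp-↭ (setoid ℕ) (λ xy y≡x → trans y≡x (xy (sym y≡x)))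
    (resp₂ _≈₀_) (↭⇒↭ₛ (↭-sym t↭′)) (padded-unique k)

  a≡b⇒a≡0 : a ≈₀ b
  a≡b⇒a≡0 = All.head (AllPairs.head t-unique)

  b≡c⇒b≡0 : b ≈₀ c
  b≡c⇒b≡0 = All.head (AllPairs.head (AllPairs.tail t-unique))

  dominated : ∀ {s f} → s ∈ toList t → f ∈ toList t → s < f →
    (s ≤ a × b ≤ f) ⊎ (s ≤ b × c ≤ f)
  dominated (here refl) (here refl)                 s<f = contradiction s<f (<-irrefl refl)
  dominated (here refl) (there (here refl))         s<f = inj₁ (≤-refl , ≤-refl)
  dominated (here refl) (there (there (here refl))) s<f = inj₁ (≤-refl , b≤c)
  dominated (there (here refl)) (here refl)         s<f = contradiction a≤b (<⇒≱ s<f)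
  dominated (there (here refl)) (there (here refl)) s<f = contradiction s<f (<-irrefl refl)
  dominated (there (here refl)) (there (there (here refl))) s<f = inj₂ (≤-refl , ≤-refl)
  dominated (there (there (here refl))) (here refl) s<f =
    contradiction (≤-trans a≤b b≤c) (<⇒≱ s<f)
  dominated (there (there (here refl))) (there (here refl)) s<f = contradiction b≤c (<⇒≱ s<f)
  dominated (there (there (here refl))) (there (there (here refl))) s<f =
    contradiction s<f (<-irrefl refl)

-- Total correctness with time bounds

-- Since execution is deterministic, the existence of one halting run is total correctness.
Within : ℕ → Program → State → (State → Set) → Set
Within t p σ Q = ∃[ s ] ∃[ τ ] (p , σ ⇓[ s ] τ) × s ≤ t × Q τ

done : ∀ {t p σ τ Q} → p , σ ⇓[ t ] τ → Q τ → Within t p σ Q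
done run q = _ , _ , run , ≤-refl , q

step : ∀ {s t p q σ τ Q} → p , σ ⇓[ s ] τ → Within t q τ Q → Within (s + t) (p ⨾ q) σ Q
step {s} run (_ , _ , run′ , t≤ , q) = _ , _ , seq run run′ , +-monoʳ-≤ s t≤ , q

bind : ∀ {s t p q σ P Q} → Within s p σ P → (∀ {τ} → P τ → Within t q τ Q) →
  Within (s + t) (p ⨾ q) σ Q
bind (_ , _ , run , s≤ , pτ) k with _ , _ , run′ , t≤ , q ← k pτ =
  _ , _ , seq run run′ , +-mono-≤ s≤ t≤ , q

weaken : ∀ {s t p σ Q} → s ≤ t → Within s p σ Q → Within t p σ Q
weaken s≤t (_ , _ , run , ≤s , q) = _ , _ , run , ≤-trans ≤s s≤t , q

conseq : ∀ {t p σ P Q} → (∀ {τ} → P τ → Q τ) → Within t p σ P → Within t p σ Q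
conseq f (_ , _ , run , ≤t , q) = _ , _ , run , ≤t , f q

then-branch : ∀ {e t p q σ Q} → ⟦ e ⟧ σ ≢ 0 → Within t p σ Q →
  Within (suc (cost e) + t) (if≢0 e then p else q) σ Q
then-branch {e} ≢0 (_ , _ , run , ≤t , q) =
  _ , _ , if-true ≢0 run , +-monoʳ-≤ (suc (cost e)) ≤t , q

else-branch : ∀ {e t p q σ Q} → ⟦ e ⟧ σ ≡ 0 → Within t q σ Q →
  Within (suc (cost e) + t) (if≢0 e then p else q) σ Q
else-branch {e} ≡0 (_ , _ , run , ≤t , q) =
  _ , _ , if-false ≡0 run , +-monoʳ-≤ (suc (cost e)) ≤t , q

stop : ∀ {e p σ Q} → ⟦ e ⟧ σ ≡ 0 → Q σ → Within (suc (cost e)) (while≢0 e loop p) σ Q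
stop ≡0 = done (while-stop ≡0)

iterate : ∀ {e s t p σ P Q} → ⟦ e ⟧ σ ≢ 0 → Within s p σ P →
  (∀ {τ} → P τ → Within t (while≢0 e loop p) τ Q) →
  Within (suc (cost e) + (s + t)) (while≢0 e loop p) σ Q
iterate {e} ≢0 (_ , _ , run , s≤ , pτ) k with _ , _ , run′ , t≤ , q ← k pτ =
  _ , _ , while-loop ≢0 run run′ , +-monoʳ-≤ (suc (cost e)) (+-mono-≤ s≤ t≤) , q

-- Lists stored in memory.

-- Seg μ a xs b: in the memory μ, the cells from a up to, excluding, b hold xs.
data Seg (μ : ℕ → ℕ) : ℕ → List ℕ → ℕ → Set where
  []  : ∀ {a} → Seg μ a [] a
  _∷_ : ∀ {a b x xs} → μ a ≡ x → Seg μ (suc a) xs b → Seg μ a (x ∷ xs) b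

_≈[_]_ : (ℕ → ℕ) → ℕ → (ℕ → ℕ) → Set
μ ≈[ t ] ν = ∀ {a} → a < t → ν a ≡ μ a

seg-≤ : ∀ {μ a xs b} → Seg μ a xs b → a ≤ b
seg-≤ []      = ≤-refl
seg-≤ (_ ∷ s) = <⇒≤ (seg-≤ s)

seg-frame : ∀ {μ ν a xs b t} → μ ≈[ t ] ν → b ≤ t → Seg μ a xs b → Seg ν a xs b
seg-frame μ≈ν b≤t []       = []
seg-frame μ≈ν b≤t (eq ∷ s) = trans (μ≈ν (≤-trans (seg-≤ s) b≤t)) eq ∷ seg-frame μ≈ν b≤t s

seg-++⁺ : ∀ {μ a xs b ys c} → Seg μ a xs b → Seg μ b ys c → Seg μ a (xs ++ ys) c
seg-++⁺ []       s′ = s′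
seg-++⁺ (eq ∷ s) s′ = eq ∷ seg-++⁺ s s′

seg-++⁻ : ∀ {μ a c} xs {ys} → Seg μ a (xs ++ ys) c → ∃[ b ] Seg μ a xs b × Seg μ b ys c
seg-++⁻ []       s        = _ , [] , s
seg-++⁻ (x ∷ xs) (eq ∷ s) with b , s₁ , s₂ ← seg-++⁻ xs s = b , eq ∷ s₁ , s₂

seg-cells : ∀ {μ} a xs → (∀ i → μ (i + a) ≡ cells xs i) → Seg μ a xs (length xs + a)
seg-cells a []       eq = []
seg-cells {μ} a (x ∷ xs) eq = eq 0 ∷ subst (Seg _ _ _) (+-suc (length xs) a)
  (seg-cells (suc a) xs λ i → trans (cong μ (+-suc i a)) (eq (suc i)))

update-same : ∀ μ a v → (μ [ a ↦ v ]) a ≡ v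
update-same μ a v with a ≡ᵇ a in eq
... | true  = refl
... | false with () ← subst T eq (≡⇒≡ᵇ a a refl)

update-other : ∀ μ {a b} v → a ≢ b → (μ [ a ↦ v ]) b ≡ μ b
update-other μ {a} {b} v a≢b with a ≡ᵇ b in eq
... | false = refl
... | true  = contradiction (≡ᵇ⇒≡ a b (subst T (sym eq) tt)) a≢b

-- Unfolds to exactly the nested updates left by consecutive stores at `tail`, `1 + tail` and so on,
-- so `write-≈` and `write-seg` apply to such code by computation alone.
write : (ℕ → ℕ) → ℕ → List ℕ → ℕ → ℕ
write μ a []       = μ
write μ a (x ∷ xs) = write (μ [ a ↦ x ]) (suc a) xs

write-≈ : ∀ μ a xs → μ ≈[ a ] write μ a xs
write-≈ μ a []       b<a = refl
write-≈ μ a (x ∷ xs) b<a =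
  trans (write-≈ _ (suc a) xs (m<n⇒m<1+n b<a))
    (update-other μ {a} {_} x λ { refl → <-irrefl refl b<a })

write-seg : ∀ μ a xs → Seg (write μ a xs) a xs (length xs + a)
write-seg μ a []       = []
write-seg μ a (x ∷ xs) =
  trans (write-≈ (μ [ a ↦ x ]) (suc a) xs {a} ≤-refl) (update-same μ a x) ∷
  subst (Seg _ _ _) (+-suc (length xs) a) (write-seg (μ [ a ↦ x ]) (suc a) xs)

flat : List Triple → List ℕ
flat []       = []
flat (t ∷ ts) = lo t ∷ mid t ∷ hi t ∷ flat ts

run : List Triple → List ℕ
run ts = length ts ∷ flat ts

-- The left-hand side has the shape of the machine expression that locates the second run: without
-- multiplication, three cells per triple means adding the length three times.
seg-flat-end : ∀ {μ a b} ts → Seg μ a (flat ts) b → a + length ts + length ts + length ts ≡ b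
seg-flat-end {a = a} []       [] rewrite +-identityʳ a | +-identityʳ a = +-identityʳ a
seg-flat-end {a = a} (t ∷ ts) (_ ∷ _ ∷ _ ∷ s) = trans (shuffle (length ts)) (seg-flat-end ts s)
  where
  shuffle : ∀ n → a + suc n + suc n + suc n ≡ 3 + a + n + n + n
  shuffle n rewrite +-suc a n | +-suc (a + n) n | +-suc (a + n + n) n = refl

ans head tail todo X Y I J A B C V : Reg
ans  = 0
head = 1
tail = 2
todo = 3
X    = 4
Y    = 5
I    = 6
J    = 7
A    = 8
B    = 9
C    = 10
V    = 11

-- All writes happen at the tail, so everything below it is preserved.
record Output (σ τ : State) (xs : List ℕ) : Set where
  constructor output
  field
    seg    : Seg (mem τ) (reg σ tail) xs (reg τ tail)
    agrees : mem σ ≈[ reg σ tail ] mem τ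
open Output

output-++ : ∀ {σ τ υ xs ys} → Output σ τ xs → Output τ υ ys → Output σ υ (xs ++ ys)
output-++ (output s ≈) (output s′ ≈′) = output
  (seg-++⁺ (seg-frame ≈′ ≤-refl s) s′)
  λ a< → trans (≈′ (<-≤-trans a< (seg-≤ s))) (≈ a<)

-- Reading the input

readLabel pushLeaf readLeaf : Program
readLabel =
  V ≔ M[ var I ] ⨾
  I ≔ lit 1 ⊕ var I ⨾
  X ≔ var X ⊖ lit 1 ⨾
  A ≔ var V ⊖ (var V ⊖ var B) ⨾
  V ≔ var B ⊕ (var V ⊖ var B) ⨾
  B ≔ var V ⊖ (var V ⊖ var C) ⨾
  C ≔ var C ⊕ (var V ⊖ var C)

pushLeaf =
  M[ var tail ]≔ lit 1 ⨾
  M[ lit 1 ⊕ var tail ]≔ var A ⨾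
  M[ lit 2 ⊕ var tail ]≔ var B ⨾
  M[ lit 3 ⊕ var tail ]≔ var C ⨾
  tail ≔ lit 4 ⊕ var tail ⨾
  todo ≔ var todo ⊖ lit 1

readLeaf =
  X ≔ M[ var I ] ⨾
  I ≔ lit 1 ⊕ var I ⨾
  A ≔ lit 0 ⨾
  B ≔ lit 0 ⨾
  C ≔ lit 0 ⨾
  (while≢0 var X loop readLabel) ⨾
  pushLeaf

held : State → Triple
held σ = ⟪ reg σ A , reg σ B , reg σ C ⟫

record LabelsRead (σ : State) (t : Triple) (b : ℕ) (τ : State) : Set where
  field
    held≡ : held τ ≡ t
    I≡    : reg τ I ≡ b
    tail≡ : reg τ tail ≡ reg σ tail
    todo≡ : reg τ todo ≡ reg σ todo
    head≡ : reg τ head ≡ reg σ head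
    mem≡  : mem τ ≡ mem σ

-- 37 is 35 for the body and 2 for the test; the final test costs another 2.
readLabels : ∀ ls {t σ b} → reg σ X ≡ length ls → held σ ≡ t → Seg (mem σ) (reg σ I) ls b →
  Within (2 + length ls * 37) (while≢0 var X loop readLabel) σ (LabelsRead σ (foldl insert t ls) b)
readLabels [] X≡ held≡ [] = stop X≡ record
  { held≡ = held≡ ; I≡ = refl ; tail≡ = refl ; todo≡ = refl ; head≡ = refl ; mem≡ = refl }
readLabels (x ∷ ls) {σ = σ} X≡ refl (x≡ ∷ s) =
  iterate {P = λ τ → reg τ X ≡ length ls × held τ ≡ insert (held σ) x ×
                     LabelsRead σ (held τ) (suc (reg σ I)) τ}
    (λ X≡0 → 1+n≢0 (trans (sym X≡) X≡0))
    (done (seq assign (seq assign (seq assign (seq assign (seq assign (seq assign assign))))))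
      (cong (_∸ 1) X≡ , cong (insert (held σ)) x≡ , record
        { held≡ = refl ; I≡ = refl ; tail≡ = refl ; todo≡ = refl ; head≡ = refl ; mem≡ = refl }))
    λ { {τ} (X≡′ , held≡ , r) → conseq (λ r′ → record
        { held≡ = LabelsRead.held≡ r′
        ; I≡    = LabelsRead.I≡ r′
        ; tail≡ = trans (LabelsRead.tail≡ r′) (LabelsRead.tail≡ r)
        ; todo≡ = trans (LabelsRead.todo≡ r′) (LabelsRead.todo≡ r)
        ; head≡ = trans (LabelsRead.head≡ r′) (LabelsRead.head≡ r)
        ; mem≡  = trans (LabelsRead.mem≡ r′) (LabelsRead.mem≡ r) })
      (readLabels ls X≡′ held≡
        (subst₂ (λ μ a → Seg μ a ls _) (sym (LabelsRead.mem≡ r)) (sym (LabelsRead.I≡ r)) s)) }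

runs : List (List Triple) → List ℕ
runs = concatMap run

output-[] : ∀ {σ τ} → reg τ tail ≡ reg σ tail → mem τ ≡ mem σ → Output σ τ []
output-[] {σ} {τ} tail≡ mem≡ = output
  (subst (Seg (mem τ) (reg σ tail) []) (sym tail≡) []) (λ {a} _ → cong (λ μ → μ a) mem≡)

record LeafRead (σ : State) (t : Triple) (b : ℕ) (τ : State) : Set where
  field
    out   : Output σ τ (run [ t ])
    I≡    : reg τ I ≡ b
    todo≡ : reg τ todo ≡ reg σ todo ∸ 1
    head≡ : reg τ head ≡ reg σ head

leafPush : ∀ σ → Within 26 pushLeaf σ (LeafRead σ (held σ) (reg σ I))
leafPush σ = done (seq store (seq store (seq store (seq store (seq assign assign))))) record
  { out   = output (write-seg (mem σ) (reg σ tail) (run [ held σ ]))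
                   (write-≈ (mem σ) (reg σ tail) (run [ held σ ]))
  ; I≡    = refl
  ; todo≡ = refl
  ; head≡ = refl
  }

leafCells : List ℕ → List ℕ
leafCells ls = length ls ∷ ls

leaf-run : List ℕ → List Triple
leaf-run ls = [ triple-of ls ]

readLeaf-spec : ∀ ls {σ b} → length ls ≤ 3 → Seg (mem σ) (reg σ I) (leafCells ls) b →
  Within 152 readLeaf σ (LeafRead σ (triple-of ls) b)
readLeaf-spec ls len≤3 (len≡ ∷ s) =
  step assign (step assign (step assign (step assign (step assign
    (bind (weaken (+-monoʳ-≤ 2 (*-monoˡ-≤ 37 len≤3)) (readLabels ls len≡ refl s))
      λ {τ} r → conseq (λ r′ → rebase (combine r r′)) (leafPush τ))))))
  where
  rebase : ∀ {σ t b x i τ} →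
    LeafRead ⟨ reg σ [ X ↦ x ] [ I ↦ i ] [ A ↦ 0 ] [ B ↦ 0 ] [ C ↦ 0 ] , mem σ ⟩ t b τ →
    LeafRead σ t b τ
  rebase record { out = out ; I≡ = I≡ ; todo≡ = todo≡ ; head≡ = head≡ } = record
    { out = output (seg out) (agrees out) ; I≡ = I≡ ; todo≡ = todo≡ ; head≡ = head≡ }

  combine : ∀ {t b σ τ υ} → LabelsRead σ t b τ → LeafRead τ (held τ) (reg τ I) υ → LeafRead σ t b υ
  combine r r′ = record
    { out   = subst (λ t → Output _ _ (run [ t ])) (LabelsRead.held≡ r)
                (output-++ (output-[] (LabelsRead.tail≡ r) (LabelsRead.mem≡ r)) (LeafRead.out r′))
    ; I≡    = trans (LeafRead.I≡ r′) (LabelsRead.I≡ r)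
    ; todo≡ = trans (LeafRead.todo≡ r′) (cong (_∸ 1) (LabelsRead.todo≡ r))
    ; head≡ = trans (LeafRead.head≡ r′) (LabelsRead.head≡ r)
    }

LeavesRead : State → List (List ℕ) → State → Set
LeavesRead σ lss τ =
  Output σ τ (runs (map leaf-run lss)) × reg τ head ≡ reg σ head

-- The bound `b ≤ reg σ tail` keeps the unread input below the output, so pushing a leaf cannot
-- destroy it.
readLeaves : ∀ lss {σ b} → All (λ ls → length ls ≤ 3) lss → reg σ todo ≡ length lss →
  Seg (mem σ) (reg σ I) (concat (map leafCells lss)) b → b ≤ reg σ tail →
  Within (2 + length lss * 154) (while≢0 var todo loop readLeaf) σ (LeavesRead σ lss)
readLeaves [] [] todo≡ _ _ = stop todo≡ (output [] (λ _ → refl) , refl)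
readLeaves (ls ∷ lss) {σ} {b} (len≤3 ∷ lens≤3) todo≡ s b≤tail
  with c , s₁ , s₂ ← seg-++⁻ (leafCells ls) s =
  iterate (λ todo≡0 → 1+n≢0 (trans (sym todo≡) todo≡0)) (readLeaf-spec ls len≤3 s₁) rest
  where
  rest : ∀ {τ} → LeafRead σ (triple-of ls) c τ →
    Within (2 + length lss * 154) (while≢0 var todo loop readLeaf) τ (LeavesRead σ (ls ∷ lss))
  rest record { out = out ; I≡ = refl ; todo≡ = todo≡′ ; head≡ = head≡ } = conseq
    (λ { (out′ , head≡′) → output-++ out out′ , trans head≡′ head≡ })
    (readLeaves lss lens≤3 (trans todo≡′ (cong (_∸ 1) todo≡))
      (seg-frame (agrees out) b≤tail s₂) (≤-trans b≤tail (seg-≤ (seg out))))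

-- Merge sort on a queue of runs

byMid : DecTotalOrder _ _ _
byMid = On.decTotalOrder ≤-decTotalOrder mid

open DecTotalOrder byMid using (totalOrder) renaming (_≤?_ to _≼?_)

_⋎_ : List Triple → List Triple → List Triple
_⋎_ = merge _≼?_

merge-≤ : ∀ {t u} ts us → mid t ≤ mid u → (t ∷ ts) ⋎ (u ∷ us) ≡ t ∷ (ts ⋎ (u ∷ us))
merge-≤ {t} {u} ts us t≤u = 
  cong (if_then t ∷ (ts ⋎ (u ∷ us)) else u ∷ ((t ∷ ts) ⋎ us)) (dec-true (t ≼? u) t≤u)

merge-> : ∀ {t u} ts us → ¬ mid t ≤ mid u → (t ∷ ts) ⋎ (u ∷ us) ≡ u ∷ ((t ∷ ts) ⋎ us)
merge-> {t} {u} ts us t≰u = 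
  cong (if_then t ∷ (ts ⋎ (u ∷ us)) else u ∷ ((t ∷ ts) ⋎ us)) (dec-false (t ≼? u) t≰u)

merge-[] : ∀ ts → ts ⋎ [] ≡ ts
merge-[] []      = refl
merge-[] (_ ∷ _) = refl

length-merge : ∀ ts us → length (ts ⋎ us) ≡ length ts + length us
length-merge ts us = trans (↭-length (merge-↭ _≼?_ ts us)) (length-++ ts)

≡suc⇒≢0 : ∀ {m n} → m ≡ suc n → m ≢ 0
≡suc⇒≢0 refl ()

push takeFirst takeSecond mergeStep mergeRuns : Program
push =
  M[ var tail ]≔ var A ⨾
  M[ lit 1 ⊕ var tail ]≔ var B ⨾
  M[ lit 2 ⊕ var tail ]≔ var C ⨾
  tail ≔ lit 3 ⊕ var tail

takeFirst =
  A ≔ M[ var I ] ⨾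
  B ≔ M[ lit 1 ⊕ var I ] ⨾
  C ≔ M[ lit 2 ⊕ var I ] ⨾
  I ≔ lit 3 ⊕ var I ⨾
  X ≔ var X ⊖ lit 1 ⨾
  push

takeSecond =
  A ≔ M[ var J ] ⨾
  B ≔ M[ lit 1 ⊕ var J ] ⨾
  C ≔ M[ lit 2 ⊕ var J ] ⨾
  J ≔ lit 3 ⊕ var J ⨾
  Y ≔ var Y ⊖ lit 1 ⨾
  push

mergeStep =
  if≢0 var Y
  then if≢0 var X
    then if≢0 M[ lit 1 ⊕ var I ] ⊖ M[ lit 1 ⊕ var J ] then takeSecond else takeFirst
    else takeSecond
  else takeFirst

mergeRuns =
  X ≔ M[ var head ] ⨾
  I ≔ lit 1 ⊕ var head ⨾
  J ≔ var I ⊕ var X ⊕ var X ⊕ var X ⨾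
  Y ≔ M[ var J ] ⨾
  J ≔ lit 1 ⊕ var J ⨾
  M[ var tail ]≔ var X ⊕ var Y ⨾
  tail ≔ lit 1 ⊕ var tail ⨾
  (while≢0 var X ⊕ var Y loop mergeStep) ⨾
  head ≔ var J ⨾
  todo ≔ var todo ⊖ lit 1

record Merging (i j : ℕ) (ts us : List Triple) (σ : State) : Set where
  field
    X≡     : reg σ X ≡ length ts
    Y≡     : reg σ Y ≡ length us
    first  : Seg (mem σ) (reg σ I) (flat ts) i
    second : Seg (mem σ) (reg σ J) (flat us) j
    i≤tail : i ≤ reg σ tail
    j≤tail : j ≤ reg σ tail

Took : ℕ → ℕ → State → List Triple → List Triple → Triple → State → Set
Took i j σ ts us t τ =
  Merging i j ts us τ × Output σ τ (flat [ t ]) × reg τ todo ≡ reg σ todo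

compared : ∀ {i j t ts u us σ} → Merging i j (t ∷ ts) (u ∷ us) σ →
  mem σ (suc (reg σ I)) ∸ mem σ (suc (reg σ J)) ≡ mid t ∸ mid u
compared record { first = _ ∷ b≡ ∷ _ ; second = _ ∷ b≡′ ∷ _ } = cong₂ _∸_ b≡ b≡′

first-taken : ∀ {i j t ts us σ} → Merging i j (t ∷ ts) us σ →
  Within 38 takeFirst σ (Took i j σ ts us t)
first-taken {t = t} {σ = σ}
  record { X≡ = X≡ ; Y≡ = Y≡ ; first = a≡ ∷ b≡ ∷ c≡ ∷ s ; second = s′ ; i≤tail = i≤ ; j≤tail = j≤ }
  with refl ← a≡ | refl ← b≡ | refl ← c≡ =
  done (seq assign (seq assign (seq assign (seq assign (seq assign
         (seq store (seq store (seq store assign))))))))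
    (record { X≡ = cong (_∸ 1) X≡ ; Y≡ = Y≡
            ; first = seg-frame below i≤ s ; second = seg-frame below j≤ s′
            ; i≤tail = m≤n⇒m≤o+n 3 i≤ ; j≤tail = m≤n⇒m≤o+n 3 j≤ } ,
     output (write-seg (mem σ) (reg σ tail) (flat [ t ])) below , refl)
  where
  below : mem σ ≈[ reg σ tail ] write (mem σ) (reg σ tail) (flat [ t ])
  below = write-≈ (mem σ) (reg σ tail) (flat [ t ])

second-taken : ∀ {i j ts u us σ} → Merging i j ts (u ∷ us) σ →
  Within 38 takeSecond σ (Took i j σ ts us u)
second-taken {u = u} {σ = σ}
  record { X≡ = X≡ ; Y≡ = Y≡ ; first = s ; second = a≡ ∷ b≡ ∷ c≡ ∷ s′ ; i≤tail = i≤ ; j≤tail = j≤ }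
  with refl ← a≡ | refl ← b≡ | refl ← c≡ =
  done (seq assign (seq assign (seq assign (seq assign (seq assign
         (seq store (seq store (seq store assign))))))))
    (record { X≡ = X≡ ; Y≡ = cong (_∸ 1) Y≡
            ; first = seg-frame below i≤ s ; second = seg-frame below j≤ s′
            ; i≤tail = m≤n⇒m≤o+n 3 i≤ ; j≤tail = m≤n⇒m≤o+n 3 j≤ } ,
     output (write-seg (mem σ) (reg σ tail) (flat [ u ])) below , refl)
  where
  below : mem σ ≈[ reg σ tail ] write (mem σ) (reg σ tail) (flat [ u ])
  below = write-≈ (mem σ) (reg σ tail) (flat [ u ])

-- `J` ends just past the second run, where the rest of the queue begins; hence `head ≔ var J`
-- dequeues both runs.
Merged : State → ℕ → List Triple → State → Set
Merged σ j ts τ = Output σ τ (flat ts) × reg τ J ≡ j × reg τ todo ≡ reg σ todo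

-- 56 is 52 for the slowest path through `mergeStep`, with all three tests, and 4 for the loop test.
MergesWithin : ℕ → List Triple → List Triple → State → Set
MergesWithin j ts us σ =
  Within (4 + length (ts ⋎ us) * 56) (while≢0 var X ⊕ var Y loop mergeStep) σ
    (Merged σ j (ts ⋎ us))

mergeNext : ∀ {t ts us i j σ} → reg σ X + reg σ Y ≢ 0 →
  Within 52 mergeStep σ (Took i j σ ts us t) →
  (∀ {τ} → Merging i j ts us τ → MergesWithin j ts us τ) →
  Within (4 + suc (length (ts ⋎ us)) * 56) (while≢0 var X ⊕ var Y loop mergeStep) σ
    (Merged σ j (t ∷ (ts ⋎ us)))
mergeNext ≢0 body continue = iterate ≢0 body λ { (inv , out , todo≡) →
  conseq (λ { (out′ , J≡ , todo≡′) → output-++ out out′ , J≡ , trans todo≡′ todo≡ })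
    (continue inv) }

-- The recursive calls enter as continuations, so the case split on the middle labels stays outside
-- `mergeLoop`, whose recursion is then plainly structural.
mergeSmaller : ∀ {t ts u us i j σ} → Merging i j (t ∷ ts) (u ∷ us) σ →
  (∀ {τ} → Merging i j ts (u ∷ us) τ → MergesWithin j ts (u ∷ us) τ) →
  (∀ {τ} → Merging i j (t ∷ ts) us τ → MergesWithin j (t ∷ ts) us τ) →
  MergesWithin j (t ∷ ts) (u ∷ us) σ
mergeSmaller {t} {ts} {u} {us} m continue₁ continue₂ with mid t ≤? mid u
... | yes t≤u = subst (λ vs → Within (4 + length vs * 56) _ _ (Merged _ _ vs))
  (sym (merge-≤ ts us t≤u))
  (mergeNext (≡suc⇒≢0 X≡ ∘ m+n≡0⇒m≡0 _)
    (then-branch (≡suc⇒≢0 Y≡) (then-branch (≡suc⇒≢0 X≡)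
      (else-branch (trans (compared m) (m≤n⇒m∸n≡0 t≤u)) (first-taken m))))
    continue₁)
  where open Merging m
... | no t≰u = subst (λ vs → Within (4 + length vs * 56) _ _ (Merged _ _ vs))
  (sym (merge-> ts us t≰u))
  (mergeNext (≡suc⇒≢0 X≡ ∘ m+n≡0⇒m≡0 _)
    (then-branch (≡suc⇒≢0 Y≡) (then-branch (≡suc⇒≢0 X≡)
      (then-branch (λ eq → m>n⇒m∸n≢0 (≰⇒> t≰u) (trans (sym (compared m)) eq))
        (second-taken m))))
    continue₂)
  where open Merging m

mergeLoop : ∀ ts us {i j σ} → Merging i j ts us σ → MergesWithin j ts us σ
mergeLoop [] [] record { X≡ = X≡ ; Y≡ = Y≡ ; second = [] } =
  stop (cong₂ _+_ X≡ Y≡) (output [] (λ _ → refl) , refl , refl)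
mergeLoop [] (u ∷ us) {σ = σ} m = mergeNext
  (≡suc⇒≢0 Y≡ ∘ m+n≡0⇒n≡0 (reg σ X))
  (weaken (≤ᵇ⇒≤ 42 52 tt) (then-branch (≡suc⇒≢0 Y≡) (else-branch X≡ (second-taken m))))
  (mergeLoop [] us)
  where open Merging m
mergeLoop (t ∷ ts) [] m = subst
  (λ vs → Within (4 + suc (length vs) * 56) _ _ (Merged _ _ (t ∷ vs))) (merge-[] ts)
  (mergeNext (≡suc⇒≢0 X≡ ∘ m+n≡0⇒m≡0 _)
    (weaken (≤ᵇ⇒≤ 40 52 tt) (else-branch Y≡ (first-taken m)))
    (mergeLoop ts []))
  where open Merging m
mergeLoop (t ∷ ts) (u ∷ us) m = mergeSmaller m (mergeLoop ts (u ∷ us)) (mergeLoop (t ∷ ts) us)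

Queue : List (List Triple) → State → Set
Queue q σ = Seg (mem σ) (reg σ head) (runs q) (reg σ tail)

runs-snoc : ∀ q ts → runs (q ++ [ ts ]) ≡ runs q ++ run ts
runs-snoc q ts = trans (concatMap-++ run q [ ts ]) (cong (runs q ++_) (++-identityʳ (run ts)))

mergeRuns-spec : ∀ ts us q {σ} → Queue (ts ∷ us ∷ q) σ →
  Within (41 + length (ts ⋎ us) * 56) mergeRuns σ
    (λ τ → Queue (q ++ [ ts ⋎ us ]) τ × reg τ todo ≡ reg σ todo ∸ 1)
mergeRuns-spec ts us q {σ} (x≡ ∷ s)
  with i , s₁ , s ← seg-++⁻ (flat ts) s
  with refl ← seg-flat-end ts s₁
  with y≡ ∷ s ← subst (λ n → Seg (mem σ) (suc (reg σ head) + n + n + n) _ _) (sym x≡) s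
  with j , s₂ , s₃ ← seg-++⁻ (flat us) s =
  weaken (≤-reflexive (time (length (ts ⋎ us) * 56)))
    (step assign (step assign (step assign (step assign (step assign (step store (step assign
      (bind (mergeLoop ts us (record
          { X≡ = x≡ ; Y≡ = y≡
          ; first  = seg-frame below (≤-trans (n≤1+n _) start≤tail) s₁
          ; second = seg-frame below (seg-≤ s₃) s₂
          ; i≤tail = m≤n⇒m≤1+n (≤-trans (n≤1+n _) start≤tail)
          ; j≤tail = m≤n⇒m≤1+n (seg-≤ s₃) }))
        λ { (out , refl , todo≡) →
          done (seq assign assign) (appended out , cong (_∸ 1) todo≡) }))))))))
  where
  time : ∀ n → 31 + (4 + n + 6) ≡ 41 + n
  time n = cong (35 +_) (+-comm n 6)

  start = suc (reg σ head) + length ts + length ts + length ts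

  start≤tail : suc start ≤ reg σ tail
  start≤tail = subst (λ n → suc (suc (reg σ head) + n + n + n) ≤ reg σ tail) x≡
    (≤-trans (seg-≤ s₂) (seg-≤ s₃))

  total : ℕ
  total = mem σ (reg σ head) +
    mem σ (suc (reg σ head) + mem σ (reg σ head) + mem σ (reg σ head) + mem σ (reg σ head))

  total≡ : total ≡ length (ts ⋎ us)
  total≡ = trans (cong₂ _+_ x≡ y≡) (sym (length-merge ts us))

  below : mem σ ≈[ reg σ tail ] write (mem σ) (reg σ tail) [ total ]
  below = write-≈ (mem σ) (reg σ tail) [ total ]

  appended : ∀ {τ r} →
    Output ⟨ r [ tail ↦ suc (reg σ tail) ] , write (mem σ) (reg σ tail) [ total ] ⟩ τ
      (flat (ts ⋎ us)) →
    Seg (mem τ) j (runs (q ++ [ ts ⋎ us ])) (reg τ tail)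
  appended {τ} {r} out = subst (λ xs → Seg (mem τ) j xs (reg τ tail)) (sym (runs-snoc q (ts ⋎ us)))
    (seg-++⁺ (seg-frame (agrees out′) ≤-refl s₃) (seg out′))
    where
    out′ : Output σ τ (run (ts ⋎ us))
    out′ = subst (λ n → Output σ τ (n ∷ flat (ts ⋎ us))) total≡
      (output-++ (output (write-seg (mem σ) (reg σ tail) [ total ]) below) out)

-- The extra unit per run pays for the overhead of a merge: two runs contribute 2 * 56 = 112, more
-- than the fixed cost 43. Merging lowers the total by one, so the initial weight bounds every
-- round.
weight : List (List Triple) → ℕ
weight q = sum (map (suc ∘ length) q)

weight-++ : ∀ q r → weight (q ++ r) ≡ weight q + weight r
weight-++ q r = trans (cong sum (map-++ (suc ∘ length) q r)) (sum-++ (map (suc ∘ length) q) _)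

module _ (base : List Triple) (W : ℕ) where

  record Sorting (q : List (List Triple)) (σ : State) : Set where
    field
      queue   : Queue q σ
      todo≡   : length q ≡ suc (reg σ todo)
      sorted  : All (Sorted totalOrder) q
      perm    : concat q ↭ base
      weight≤ : weight q ≤ W

  mergeRuns-sorting : ∀ ts us q {σ} → Sorting (ts ∷ us ∷ q) σ →
    Within (41 + (length ts + length us) * 56) mergeRuns σ (Sorting (q ++ [ ts ⋎ us ]))
  mergeRuns-sorting ts us q {σ}
    record { queue = queue ; todo≡ = todo≡ ; sorted = s₁ ∷ s₂ ∷ s
           ; perm = perm ; weight≤ = weight≤ } =
    subst (λ n → Within (41 + n * 56) mergeRuns σ (Sorting (q ++ [ ts ⋎ us ]))) (length-merge ts us)
      (conseq (λ { {τ} (queue′ , todo≡′) → record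
          { queue   = queue′
          ; todo≡   = trans (length-++ q) (trans (+-comm (length q) 1)
              (trans (suc-injective todo≡) (trans (todo-pos todo≡) (cong suc (sym todo≡′)))))
          ; sorted  = All.++⁺ s (merge⁺ byMid s₁ s₂ ∷ [])
          ; perm    = ↭-trans perm′ perm
          ; weight≤ = ≤-trans weight≤′ weight≤ } })
        (mergeRuns-spec ts us q queue))
    where
    todo-pos : ∀ {n k} → suc (suc k) ≡ suc n → n ≡ suc (n ∸ 1)
    todo-pos refl = refl

    perm′ : concat (q ++ [ ts ⋎ us ]) ↭ ts ++ (us ++ concat q)
    perm′ = begin
      concat (q ++ [ ts ⋎ us ])          ≡⟨ concat-++ q [ ts ⋎ us ] ⟨
      concat q ++ ((ts ⋎ us) ++ [])      ≡⟨ cong (concat q ++_) (++-identityʳ (ts ⋎ us)) ⟩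
      concat q ++ (ts ⋎ us)              ↭⟨ ++-comm (concat q) (ts ⋎ us) ⟩
      (ts ⋎ us) ++ concat q              ↭⟨ ++⁺ʳ (concat q) (merge-↭ _≼?_ ts us) ⟩
      (ts ++ us) ++ concat q             ≡⟨ ++-assoc ts us (concat q) ⟩
      ts ++ (us ++ concat q)             ∎
      where open PermutationReasoning

    weight≤′ : weight (q ++ [ ts ⋎ us ]) ≤ weight (ts ∷ us ∷ q)
    weight≤′ = begin
      weight (q ++ [ ts ⋎ us ])                        ≡⟨ weight-++ q [ ts ⋎ us ] ⟩
      weight q + (suc (length (ts ⋎ us)) + 0)          ≡⟨ cong (weight q +_) (+-identityʳ _) ⟩
      weight q + suc (length (ts ⋎ us))                ≡⟨ +-comm (weight q) _ ⟩
      suc (length (ts ⋎ us)) + weight q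
        ≡⟨ cong (λ n → suc n + weight q) (length-merge ts us) ⟩
      suc (length ts + length us) + weight q
        ≤⟨ +-monoˡ-≤ (weight q) (+-monoʳ-≤ (suc (length ts)) (n≤1+n (length us))) ⟩
      suc (length ts) + suc (length us) + weight q     ≡⟨ +-assoc (suc (length ts)) _ _ ⟩
      weight (ts ∷ us ∷ q)                             ∎
      where open ≤-Reasoning

  -- A round merges the runs present at its start in pairs: it takes time O(W)
  -- and halves the number of runs.
  sortLoop : ∀ k {q σ} → length q ≤ 2 ^ k → Sorting q σ →
    Within (2 + k * (W * 56)) (while≢0 var todo loop mergeRuns) σ (λ τ → ∃[ ts ] Sorting [ ts ] τ)

  -- `old` are the runs still to be paired in this round, `new` the results already appended. A
  -- merge trades two old runs for one new run, which preserves the sum in the bound.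
  sortRound : ∀ k old new {σ} → length old + 2 * length new ≤ 2 ^ suc k → Sorting (old ++ new) σ →
    Within (weight old * 56 + (2 + k * (W * 56))) (while≢0 var todo loop mergeRuns) σ
      (λ τ → ∃[ ts ] Sorting [ ts ] τ)

  sortLoop zero    {[]}        _          s with () ← Sorting.todo≡ s
  sortLoop zero    {ts ∷ []}   _          s = stop (sym (suc-injective (Sorting.todo≡ s))) (ts , s)
  sortLoop zero    {_ ∷ _ ∷ _} (s≤s ()) s
  sortLoop (suc k) {q} {σ} len s = weaken time (sortRound k q [] len′ s′)
    where
    s′ : Sorting (q ++ []) σ
    s′ = subst (λ q → Sorting q σ) (sym (++-identityʳ q)) s
    len′ : length q + 0 ≤ 2 ^ suc k
    len′ = ≤-trans (≤-reflexive (+-identityʳ (length q))) len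
    time : weight q * 56 + (2 + k * (W * 56)) ≤ 2 + (W * 56 + k * (W * 56))
    time = begin
      weight q * 56 + (2 + k * (W * 56)) ≤⟨ +-monoˡ-≤ _ (*-monoˡ-≤ 56 (Sorting.weight≤ s)) ⟩
      W * 56 + (2 + k * (W * 56))        ≡⟨ x∙yz≈y∙xz (W * 56) 2 _ ⟩
      2 + (W * 56 + k * (W * 56))        ∎
      where open ≤-Reasoning

  sortRound k []           new len s = sortLoop k (*-cancelˡ-≤ 2 len) s
  -- An unpaired run is carried into the next round. From 1 + 2 * `length new` ≤ 2 * 2 ^ k follows
  -- `length new` < 2 ^ k, which leaves room for it.
  sortRound k (ts ∷ [])    new len s = weaken (m≤n+m _ (weight [ ts ] * 56))
    (sortLoop k (*-cancelˡ-< 2 (length new) (2 ^ k) len) s)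
  sortRound k (ts ∷ us ∷ old) new {σ} len s = weaken time
    (iterate (≡suc⇒≢0 (sym (suc-injective (Sorting.todo≡ s))))
      (mergeRuns-sorting ts us (old ++ new) s)
      λ {τ} s′ → sortRound k old (new ++ [ ts ⋎ us ]) len′
        (subst (λ q → Sorting q τ) (++-assoc old new [ ts ⋎ us ]) s′))
    where
    len′ : length old + 2 * length (new ++ [ ts ⋎ us ]) ≤ 2 ^ suc k
    len′ = begin
      length old + 2 * length (new ++ [ ts ⋎ us ])
        ≡⟨ cong (λ n → length old + 2 * n) (trans (length-++ new) (+-comm (length new) 1)) ⟩
      length old + 2 * suc (length new)            ≡⟨ cong (length old +_) (*-suc 2 (length new)) ⟩
      length old + (2 + 2 * length new)            ≡⟨ x∙yz≈y∙xz (length old) 2 _ ⟩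
      2 + (length old + 2 * length new)            ≤⟨ len ⟩
      2 ^ suc k                                    ∎
      where open ≤-Reasoning

    rest : ℕ
    rest = 2 + k * (W * 56)

    lengths : suc (suc (length ts + length us)) ≡ suc (length ts) + suc (length us)
    lengths = cong suc (sym (+-suc (length ts) (length us)))

    time : 2 + ((41 + (length ts + length us) * 56) + (weight old * 56 + rest)) ≤
           weight (ts ∷ us ∷ old) * 56 + rest
    time = begin
      43 + (length ts + length us) * 56 + (weight old * 56 + rest)
        ≤⟨ +-monoˡ-≤ _ (+-monoˡ-≤ ((length ts + length us) * 56) (≤ᵇ⇒≤ 43 112 tt)) ⟩
      suc (suc (length ts + length us)) * 56 + (weight old * 56 + rest)
        ≡⟨ cong (λ n → n * 56 + (weight old * 56 + rest)) lengths ⟩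
      (suc (length ts) + suc (length us)) * 56 + (weight old * 56 + rest)
        ≡⟨ +-assoc ((suc (length ts) + suc (length us)) * 56) (weight old * 56) rest ⟨
      (suc (length ts) + suc (length us)) * 56 + weight old * 56 + rest
        ≡⟨ cong (_+ rest) (*-distribʳ-+ 56 (suc (length ts) + suc (length us)) (weight old)) ⟨
      (suc (length ts) + suc (length us) + weight old) * 56 + rest
        ≡⟨ cong (λ n → n * 56 + rest) (+-assoc (suc (length ts)) (suc (length us)) (weight old)) ⟩
      weight (ts ∷ us ∷ old) * 56 + rest ∎
      where open ≤-Reasoning

-- The greedy scan

scanStep scan : Program
scanStep =
  if≢0 M[ var I ] ⊖ var V
  then (V ≔ M[ lit 1 ⊕ var I ] ⨾ I ≔ lit 3 ⊕ var I ⨾ X ≔ var X ⊖ lit 1)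
  else if≢0 M[ lit 1 ⊕ var I ] ⊖ var V
    then (V ≔ M[ lit 2 ⊕ var I ] ⨾ I ≔ lit 3 ⊕ var I ⨾ X ≔ var X ⊖ lit 1)
    else (ans ≔ lit 0 ⨾ X ≔ lit 0)

scan =
  X ≔ M[ var head ] ⨾
  I ≔ lit 1 ⊕ var head ⨾
  V ≔ lit 0 ⨾
  ans ≔ lit 1 ⨾
  (while≢0 var X loop scanStep)

Verdict : Set → State → Set
Verdict P τ = (reg τ ans ≡ 1 × P) ⊎ (reg τ ans ≡ 0 × ¬ P)

verdict-⇔ : ∀ {P Q} τ → (P → Q) × (¬ P → ¬ Q) → Verdict P τ → Verdict Q τ
verdict-⇔ τ (f , _) (inj₁ (eq , p))  = inj₁ (eq , f p)
verdict-⇔ τ (_ , g) (inj₂ (eq , ¬p)) = inj₂ (eq , g ¬p)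

record Scanning (e end : ℕ) (ts : List Triple) (σ : State) : Set where
  field
    X≡   : reg σ X ≡ length ts
    V≡   : reg σ V ≡ e
    ans≡ : reg σ ans ≡ 1
    seg  : Seg (mem σ) (reg σ I) (flat ts) end

-- A truncated difference is nonzero exactly when the comparison is strict, so the two tests of
-- `scanStep` decide `e < lo t` and `e < mid t`. On failure, clearing `X` ends the loop.
scanLoop : ∀ ts {e end σ} → Scanning e end ts σ →
  Within (2 + length ts * 27) (while≢0 var X loop scanStep) σ (Verdict (Greedy e ts))
scanLoop [] s = stop (Scanning.X≡ s) (inj₁ (Scanning.ans≡ s , []))
scanLoop (t ∷ ts) {e} {end} {σ}
  record { X≡ = X≡ ; V≡ = V≡ ; ans≡ = ans≡ ; seg = a≡ ∷ b≡ ∷ c≡ ∷ s }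
  with e <? lo t | e <? mid t
... | yes e<a | _ = iterate {P = Scanning (mid t) end ts} (≡suc⇒≢0 X≡)
  (weaken (≤ᵇ⇒≤ 18 25 tt) (then-branch
    (λ eq → m>n⇒m∸n≢0 e<a (trans (sym (cong₂ _∸_ a≡ V≡)) eq))
    (done (seq assign (seq assign assign))
      record { X≡ = cong (_∸ 1) X≡ ; V≡ = b≡ ; ans≡ = ans≡ ; seg = s })))
  λ s′ → conseq (λ {τ} → verdict-⇔ τ (left e<a ,
      λ { ¬g (left _ g) → ¬g g ; ¬g (right e≮a _ _) → e≮a e<a }))
    (scanLoop ts s′)
... | no e≮a | yes e<b = iterate {P = Scanning (hi t) end ts} (≡suc⇒≢0 X≡)
  (else-branch (trans (cong₂ _∸_ a≡ V≡) (m≤n⇒m∸n≡0 (≮⇒≥ e≮a)))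
    (then-branch (λ eq → m>n⇒m∸n≢0 e<b (trans (sym (cong₂ _∸_ b≡ V≡)) eq))
      (done (seq assign (seq assign assign))
        record { X≡ = cong (_∸ 1) X≡ ; V≡ = c≡ ; ans≡ = ans≡ ; seg = s })))
  λ s′ → conseq (λ {τ} → verdict-⇔ τ (right e≮a e<b ,
      λ { ¬g (left e<a _) → e≮a e<a ; ¬g (right _ _ g) → ¬g g }))
    (scanLoop ts s′)
... | no e≮a | no e≮b = weaken (m≤m+n 20 _)
  (iterate {P = λ τ → reg τ X ≡ 0 × reg τ ans ≡ 0} (≡suc⇒≢0 X≡)
  (else-branch (trans (cong₂ _∸_ a≡ V≡) (m≤n⇒m∸n≡0 (≮⇒≥ e≮a)))
    (else-branch (trans (cong₂ _∸_ b≡ V≡) (m≤n⇒m∸n≡0 (≮⇒≥ e≮b)))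
      (done (seq assign assign) (refl , refl))))
  λ { (X≡0 , ans≡0) → stop X≡0 (inj₂ (ans≡0 ,
      λ { (left e<a _) → e≮a e<a ; (right _ e<b _) → e≮b e<b })) })

scan-spec : ∀ ts {σ} → Queue [ ts ] σ → Within (13 + length ts * 27) scan σ (Verdict (Greedy 0 ts))
scan-spec ts (X≡ ∷ s) with end , s , _ ← seg-++⁻ (flat ts) s =
  step assign (step assign (step assign (step assign
    (scanLoop ts record { X≡ = X≡ ; V≡ = refl ; ans≡ = refl ; seg = s }))))

-- The decision procedure

-- An input on n vertices ends before address 4 n, where the queue starts.  The queue
-- initially holds an empty run besides the n - 1 singletons, so it is never empty.
decide : Program
decide =
  head ≔ M[ lit 0 ] ⊕ M[ lit 0 ] ⊕ M[ lit 0 ] ⊕ M[ lit 0 ] ⨾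
  todo ≔ M[ lit 0 ] ⊖ lit 1 ⨾
  I ≔ lit 1 ⨾
  tail ≔ lit 1 ⊕ var head ⨾
  M[ var head ]≔ lit 0 ⨾
  (while≢0 var todo loop readLeaf) ⨾
  todo ≔ M[ lit 0 ] ⊖ lit 1 ⨾
  (while≢0 var todo loop mergeRuns) ⨾
  scan

time : ℕ → ℕ
time n = 26 + (2 + n * 154 + (5 + (2 + ⌈log₂ n ⌉ * ((n + n) * 56) + (13 + n * 27))))

-- Asymptotics of the running time.

n≤2^⌈log₂n⌉ : ∀ n → n ≤ 2 ^ ⌈log₂ n ⌉
n≤2^⌈log₂n⌉ n = bound ⌈log₂ n ⌉ n ≤-refl
  where
  bound : ∀ k n → ⌈log₂ n ⌉ ≤ k → n ≤ 2 ^ k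
  bound zero n log≤0 with n ≤? 1
  ... | yes n≤1 = n≤1
  ... | no  n≰1 = contradiction (≤-trans (⌈log₂⌉-mono-≤ (≰⇒> n≰1)) log≤0) λ ()
  bound (suc k) n log≤ = begin
    n                     ≡⟨ ⌊n/2⌋+⌈n/2⌉≡n n ⟨
    ⌊ n /2⌋ + ⌈ n /2⌉     ≤⟨ +-monoˡ-≤ ⌈ n /2⌉ (⌊n/2⌋≤⌈n/2⌉ n) ⟩
    ⌈ n /2⌉ + ⌈ n /2⌉     ≤⟨ +-mono-≤ half≤ half≤ ⟩
    2 ^ k + 2 ^ k         ≡⟨ cong (2 ^ k +_) (+-identityʳ (2 ^ k)) ⟨
    2 ^ suc k             ∎
    where
    open ≤-Reasoning
    half≤ : ⌈ n /2⌉ ≤ 2 ^ k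
    half≤ = bound k ⌈ n /2⌉ (≤-trans (≤-reflexive (⌈log₂⌈n/2⌉⌉≡⌈log₂n⌉∸1 n)) (∸-monoˡ-≤ 1 log≤))

time∈O : time ∈O (λ n → n * ⌈log₂ n ⌉)
-- From n = 2 on the logarithm is at least 1 and absorbs the lower terms: 341 = 48 + 181 + 112. At n
-- = 1 the logarithm vanishes, so the threshold cannot be lower.
time∈O = 341 , 2 , bound
  where
  open ≤-Reasoning
  bound : ∀ n → 2 ≤ n → time n ≤ 341 * (n * ⌈log₂ n ⌉)
  bound n 2≤n = begin
    time n
      ≡⟨ solve 2 (λ n l → con 26 :+ (con 2 :+ n :* con 154 :+ (con 5 :+
            (con 2 :+ l :* ((n :+ n) :* con 56) :+ (con 13 :+ n :* con 27)))) :=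
          con 48 :+ con 181 :* n :+ con 112 :* (n :* l)) refl n ⌈log₂ n ⌉ ⟩
    48 + 181 * n + 112 * nl
      ≤⟨ +-monoˡ-≤ (112 * nl) (+-mono-≤
           (*-monoʳ-≤ 48 (≤-trans (<⇒≤ 2≤n) n≤nl)) (*-monoʳ-≤ 181 n≤nl)) ⟩
    48 * nl + 181 * nl + 112 * nl
      ≡⟨ solve 1 (λ x → con 48 :* x :+ con 181 :* x :+ con 112 :* x := con 341 :* x) refl nl ⟩
    341 * nl ∎
    where
    nl = n * ⌈log₂ n ⌉
    n≤nl : n ≤ nl
    n≤nl = ≤-trans (≤-reflexive (sym (*-identityʳ n))) (*-monoʳ-≤ n (⌈log₂⌉-mono-≤ 2≤n))

-- Correctness of the whole procedure.

length-leafCells : ∀ {lss} → All (λ ls → length ls ≤ 3) lss →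
  length (concat (map leafCells lss)) ≤ length lss * 4
length-leafCells []                      = z≤n
length-leafCells {ls ∷ _} (len≤3 ∷ lens) = ≤-trans
  (≤-reflexive (length-++ (leafCells ls))) (+-mono-≤ (s≤s len≤3) (length-leafCells lens))

weight-leaf-runs : ∀ lss → weight (map leaf-run lss) ≡ length lss * 2
weight-leaf-runs []        = refl
weight-leaf-runs (_ ∷ lss) = cong (2 +_) (weight-leaf-runs lss)

concat-leaf-runs : ∀ lss → concat (map leaf-run lss) ≡ map triple-of lss
concat-leaf-runs []         = refl
concat-leaf-runs (ls ∷ lss) = cong (triple-of ls ∷_) (concat-leaf-runs lss)

GreedyVerdict : List Triple → State → Set
GreedyVerdict base τ = ∃[ ts ] ts ↭ base × AllPairs (λ t u → mid t ≤ mid u) ts ×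
  Verdict (Greedy 0 ts) τ

module _ (lss : List (List ℕ)) (lens≤3 : All (λ ls → length ls ≤ 3) lss) where
  private
    n : ℕ
    n = suc (length lss)

    input : List ℕ
    input = n ∷ concat (map leafCells lss)

    base : List Triple
    base = map triple-of lss

    memory : ℕ → ℕ
    memory = write (cells input) (n + n + n + n) [ 0 ]

    below : cells input ≈[ n + n + n + n ] memory
    below = write-≈ (cells input) (n + n + n + n) [ 0 ]

    input≤ : length input + 0 ≤ n + n + n + n
    input≤ = begin
      suc (length (concat (map leafCells lss))) + 0 ≡⟨ +-identityʳ _ ⟩
      suc (length (concat (map leafCells lss)))     ≤⟨ s≤s (length-leafCells lens≤3) ⟩
      1 + length lss * 4                            ≤⟨ +-monoˡ-≤ (length lss * 4) (s≤s z≤n) ⟩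
      n * 4
        ≡⟨ solve 1 (λ n → n :* con 4 := n :+ n :+ n :+ n) refl n ⟩
      n + n + n + n                                 ∎
      where open ≤-Reasoning

    initial-sorting : ∀ {r τ} → r tail ≡ suc (n + n + n + n) → r head ≡ n + n + n + n →
      LeavesRead ⟨ r , memory ⟩ lss τ →
      Sorting base (n + n) ([] ∷ map leaf-run lss) ⟨ reg τ [ todo ↦ mem τ 0 ∸ 1 ] , mem τ ⟩
    initial-sorting {r} {τ} tail≡ head≡ (output segment agree , head≡′) = record
      { queue   = subst (λ h → Seg (mem τ) h (0 ∷ runs (map leaf-run lss)) (reg τ tail))
          (sym (trans head≡′ head≡))
          (seg-++⁺ (seg-frame agree′ ≤-refl (write-seg (cells input) (n + n + n + n) [ 0 ]))
            (subst (λ a → Seg (mem τ) a _ _) tail≡ segment))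
      ; todo≡   = cong suc (trans (length-map leaf-run lss) (cong (_∸ 1) (sym mem0)))
      ; sorted  = [] ∷ All.map⁺ (All.universal (λ _ → [-]) lss)
      ; perm    = ↭-reflexive (concat-leaf-runs lss)
      -- Each singleton run weighs 2 and the empty run 1.
      ; weight≤ = begin
          suc (weight (map leaf-run lss)) ≡⟨ cong suc (weight-leaf-runs lss) ⟩
          suc (length lss * 2)            ≤⟨ n≤1+n _ ⟩
          n * 2                           ≡⟨ solve 1 (λ n → n :* con 2 := n :+ n) refl n ⟩
          n + n                           ∎
      }
      where
      open ≤-Reasoning
      agree′ : memory ≈[ suc (n + n + n + n) ] mem τ
      agree′ a< = agree (subst (_ <_) (sym tail≡) a<)
      mem0 : mem τ 0 ≡ n
      mem0 = trans (agree′ (s≤s z≤n)) (below (s≤s z≤n))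

    scan-sorted : ∀ {τ} → (∃[ ts ] Sorting base (n + n) [ ts ] τ) →
      Within (13 + n * 27) scan τ (GreedyVerdict base)
    scan-sorted (ts , s) = weaken (+-monoʳ-≤ 13 (*-monoˡ-≤ 27 len≤))
      (conseq (λ v → ts , ts↭ , Sorted⇒AllPairs totalOrder (All.head (Sorting.sorted s)) , v)
        (scan-spec ts (Sorting.queue s)))
      where
      ts↭ : ts ↭ base
      ts↭ = ↭-trans (↭-reflexive (sym (++-identityʳ ts))) (Sorting.perm s)
      len≤ : length ts ≤ n
      len≤ = ≤-trans (≤-reflexive (trans (↭-length ts↭) (length-map triple-of lss))) (n≤1+n _)

  decide-spec : Within (time n) decide (initial input) (GreedyVerdict base)
  decide-spec
    with _ ∷ leaves ← seg-cells {cells input} 0 input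
                        (λ i → cong (cells input) (+-identityʳ i)) =
    step assign (step assign (step assign (step assign (step store
      (bind (weaken (+-monoʳ-≤ 2 (*-monoˡ-≤ 154 (n≤1+n (length lss))))
              (readLeaves lss lens≤3 refl (seg-frame below input≤ leaves) (m≤n⇒m≤1+n input≤)))
        λ r → step assign
          (bind (sortLoop base (n + n) ⌈log₂ n ⌉
              (≤-trans (≤-reflexive (cong suc (length-map leaf-run lss))) (n≤2^⌈log₂n⌉ n))
              (initial-sorting refl refl r))
            scan-sorted))))))

decides : ∀ {m} (S : TemporalStar m) → LabelsPerEdge≤ S 3 →
  Decides decide (Explorable S) (encode S) (time (suc m))
decides {m} S len≤3 = answer (decide-spec (tabulate labels) (All.tabulate⁺ len≤3))
  where
  open TemporalStar S using (labels; unique)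

  input≡ : suc (length (tabulate labels)) ∷ concat (map leafCells (tabulate labels)) ≡ encode S
  input≡ = cong₂ _∷_ (cong suc (length-tabulate labels))
    (cong concat (map-tabulate labels leafCells))

  triples≡ : map triple-of (tabulate labels) ≡ map (triple-of ∘ labels) (allFin m)
  triples≡ = trans (map-tabulate labels triple-of) (sym (map-tabulate id (triple-of ∘ labels)))

  answer : Within (time (suc (length (tabulate labels)))) decide
      (initial (suc (length (tabulate labels)) ∷ concat (map leafCells (tabulate labels))))
      (GreedyVerdict (map triple-of (tabulate labels))) →
    Decides decide (Explorable S) (encode S) (time (suc m))
  answer (t , τ , halts , t≤ , ts , ts↭ , sorted , verdict) =
    t , τ , subst (λ i → decide , initial i ⇓[ t ] τ) input≡ halts ,
    subst (λ n → t ≤ time (suc n)) (length-tabulate labels) t≤ ,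
    verdict-⇔ τ (greedy-decides S (triple-of ∘ labels)
        (λ i → represents-triple-of (len≤3 i) (unique i))
        (↭-trans ts↭ (↭-reflexive triples≡)) sorted)
      verdict

theorem2 : ∃[ p ] ∃[ T ] (T ∈O (λ n → n * ⌈log₂ n ⌉)) ×
    (∀ {m} (S : TemporalStar m) →
    LabelsPerEdge≤ S 3 → AllLabelsDistinct S →
    Decides p (Explorable S) (encode S) (T (suc m)))
theorem2 = decide , time , time∈O , λ S len≤3 _ → decides S len≤3
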